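{- Let $\vec r=\langle r_0,\dots,r_{n-1}\rangle$ be a finite tuple of parameters and let $\varphi\in\mathrm{Fm}(p,\vec r)$. Then $\varphi$ is a normal additive formula in $\mathrm{S5}$ (with respect to $p$) if and only if $\varphi$ is $\mathrm{S5}$-equivalent to a formula of the form $$(\lambda\wedge p)\vee\bigvee_{i<k}\bigl(\mu_i\wedge\Diamond(\nu_i\wedge p)\bigr)\vee\bot,\qquad k\in\omega,\ \lambda,\mu_i,\nu_i\in\mathrm{Fm}(\vec r).$$
   Context: Modal formulas are built from propositional variables using Boolean connectives, $\bot$, $\top$, $\Diamond$ and $\Box$. The variables $p$ and $q$ are distinct non-parameter variables; parameters are variables distinct from $p$ and $q$. $\mathrm{Fm}(p,\vec r)$ is the set of modal formulas containing no variables other than $p,r_0,\dots,r_{n-1}$; $\mathrm{Fm}(\vec r)$ is the set of modal formulas containing no variables other than $r_0,\dots,r_{n-1}$. For a normal modal logic $\Lambda$, formulas $\varphi,\psi$ are $\Lambda$-equivalent if $\Lambda\vdash\varphi\leftrightarrow\psi$. A formula $\varphi(p,\vec r)$ is additive in $\Lambda$ if $\Lambda\vdash\varphi(p\vee q,\vec r)\leftrightarrow\varphi(p,\vec r)\vee\varphi(q,\vec r)$, and normal in $\Lambda$ if $\Lambda\vdash\varphi(\bot,\vec r)\leftrightarrow\bot$; it is a normal additive formula in $\Lambda$ if it is both. $\mathrm{S5}$ is the usual normal modal logic of frames whose relation is an equivalence relation. An empty disjunction is $\bot$. -}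

module Defs where

open import Level using (0ℓ; suc)
import Data.Empty as Empty
import Data.Unit as Unit
open import Data.Nat.Base using (ℕ)
open import Data.Fin.Base using (Fin)
open import Data.List.Base using (List; []; _∷_; [_]; _++_; map)
open import Data.List.Relation.Binary.Subset.Propositional using (_⊆_)
open import Data.Product.Base using (∃-syntax; _×_)
open import Data.Sum.Base using (_⊎_)
open import Data.Vec.Base using (Vec; toList)
open import Data.Vec.Functional using (foldr)
open import Relation.Binary.Core using (Rel)
open import Relation.Binary.Structures using (IsEquivalence)
open import Relation.Nullary.Negation.Core using (¬_)
open import Relation.Unary using (Pred)

infix  9 ∼_ □_ ◇_
infix 10 _[p≔_]
infixr 8 _∧_
infixr 7 _∨_
infixr 6 _⇒_
infix  5 _⇔_
infix  4 _⊢_ _⊨_ _∈Fm_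

data Var : Set where
  p q : Var
  par : ℕ → Var

data Fm : Set where
  var         : Var → Fm
  ⊥ ⊤         : Fm
  ∼_ □_ ◇_    : Fm → Fm
  _∧_ _∨_ _⇒_ : Fm → Fm → Fm

_⇔_ : Fm → Fm → Fm
φ ⇔ ψ = (φ ⇒ ψ) ∧ (ψ ⇒ φ)

⋁ : ∀ {k} → (Fin k → Fm) → Fm
⋁ = foldr _∨_ ⊥

vars : Fm → List Var
vars (var v) = [ v ]
vars ⊥       = []
vars ⊤       = []
vars (∼ φ)   = vars φ
vars (□ φ)   = vars φ
vars (◇ φ)   = vars φ
vars (φ ∧ ψ) = vars φ ++ vars ψ
vars (φ ∨ ψ) = vars φ ++ vars ψ
vars (φ ⇒ ψ) = vars φ ++ vars ψ

_∈Fm_ : Fm → List Var → Set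
φ ∈Fm vs = vars φ ⊆ vs

-- A tuple of parameters is given by its indices; repetitions are allowed.
pars : ∀ {n} → Vec ℕ n → List Var
pars r = map par (toList r)

-- φ [p≔ χ ] is φ(χ, r⃗).
_[p≔_] : Fm → Fm → Fm
var p       [p≔ χ ] = χ
var q       [p≔ χ ] = var q
var (par i) [p≔ χ ] = var (par i)
⊥           [p≔ χ ] = ⊥
⊤           [p≔ χ ] = ⊤
(∼ φ)       [p≔ χ ] = ∼ (φ [p≔ χ ])
(□ φ)       [p≔ χ ] = □ (φ [p≔ χ ])
(◇ φ)       [p≔ χ ] = ◇ (φ [p≔ χ ])
(φ ∧ ψ)     [p≔ χ ] = (φ [p≔ χ ]) ∧ (ψ [p≔ χ ])
(φ ∨ ψ)     [p≔ χ ] = (φ [p≔ χ ]) ∨ (ψ [p≔ χ ])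
(φ ⇒ ψ)     [p≔ χ ] = (φ [p≔ χ ]) ⇒ (ψ [p≔ χ ])

record Frame : Set₁ where
  field
    World : Set
    _R_   : Rel World 0ℓ

-- Kripke's clauses, read classically: in Agda's constructive logic the
-- positive clauses (variables, ∨, ◇) must carry a double negation, or else
-- already p ∨ ∼ p would fail to be valid.  All the remaining clauses
-- preserve ¬¬-stability, so w ⊩ φ is ¬¬-stable for every φ, and in a
-- classical metatheory this is the ordinary forcing relation.
module Forcing (F : Frame) (V : Var → Pred (Frame.World F) 0ℓ) where
  open Frame F

  infix 4 _⊩_

  _⊩_ : World → Fm → Set
  w ⊩ var v = ¬ ¬ V v w
  w ⊩ ⊥     = Empty.⊥
  w ⊩ ⊤     = Unit.⊤
  w ⊩ ∼ φ   = ¬ (w ⊩ φ)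
  w ⊩ φ ∧ ψ = (w ⊩ φ) × (w ⊩ ψ)
  w ⊩ φ ∨ ψ = ¬ ¬ ((w ⊩ φ) ⊎ (w ⊩ ψ))
  w ⊩ φ ⇒ ψ = w ⊩ φ → w ⊩ ψ
  w ⊩ □ φ   = ∀ u → w R u → u ⊩ φ
  w ⊩ ◇ φ   = ¬ ¬ (∃[ u ] (w R u × u ⊩ φ))

_⊨_ : Frame → Fm → Set₁
F ⊨ φ = ∀ V w → Forcing._⊩_ F V w φ

Logic : Set₂
Logic = Pred Fm (suc 0ℓ)

_⊢_ : Logic → Fm → Set₁
Λ ⊢ φ = Λ φ

LogicOf : Pred Frame 0ℓ → Logic
LogicOf C φ = ∀ F → C F → F ⊨ φ

S5 : Logic
S5 = LogicOf λ F → IsEquivalence (Frame._R_ F)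

Equivalent : Logic → Fm → Fm → Set₁
Equivalent Λ φ ψ = Λ ⊢ φ ⇔ ψ

Additive : Logic → Fm → Set₁
Additive Λ φ = Λ ⊢ φ [p≔ var p ∨ var q ] ⇔ φ [p≔ var p ] ∨ φ [p≔ var q ]

Normal : Logic → Fm → Set₁
Normal Λ φ = Λ ⊢ φ [p≔ ⊥ ] ⇔ ⊥

NormalAdditive : Logic → Fm → Set₁
NormalAdditive Λ φ = Normal Λ φ × Additive Λ φ

{-# OPTIONS --safe #-}
-- Only the direction producing the normal form needs an idea.  Doubling every world of an S5 model
-- changes no truth value, so p may be split, within the cluster of the current world w, into pieces
-- each of which lies in one layer of the doubled model and in one of the 2ⁿ atoms over r⃗.  By
-- additivity φ holds at w iff it holds there for some piece, and by normality that piece is nonempty.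
-- For such a piece every world has a copy outside p, and all the worlds in p satisfy the same
-- parameters; hence the value of φ at w depends only on the atom, on the parameters in the original
-- model, and on whether w itself lies in the piece, and it is expressed by a formula in Fm(r⃗).  The
-- disjunct λ ∧ p collects the pieces containing w; μᵢ ∧ ◇(νᵢ ∧ p) accounts for the others.
module Submission where

open import Level using (0ℓ)
open import Data.Bool.Base using (Bool; true; false; not; if_then_else_)
open import Data.Bool.Properties using (not-¬)
open import Data.Nat.Base using (ℕ; zero; suc)
open import Data.Nat.Properties using (_≟_)
open import Data.Fin.Base using (Fin; zero; suc)
open import Data.List.Base using (List; []; _∷_; [_]; _++_; length; lookup; cartesianProductWith)
open import Data.List.Membership.Propositional using (_∈_; _∉_)
open import Data.List.Membership.Propositional.Properties using (∈-++⁺ˡ; ∈-++⁺ʳ; ∈-++⁻; ∈-map⁻; ∈-cartesianProductWith⁺)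
open import Data.List.Relation.Binary.Subset.Propositional using (_⊆_)
open import Data.List.Relation.Binary.Subset.Propositional.Properties using (++⁺)
open import Data.List.Relation.Unary.Any using (here; there; index)
open import Data.List.Relation.Unary.Any.Properties using (lookup-index)
open import Data.Product.Base using (∃; ∃-syntax; Σ-syntax; _×_; _,_; proj₁; proj₂)
open import Data.Product.Function.NonDependent.Propositional using (_×-⇔_)
open import Data.Sum.Base as Sum using (_⊎_; inj₁; inj₂; [_,_]′)
open import Data.Sum.Function.Propositional using (_⊎-⇔_)
open import Data.Vec.Base using (Vec; []; _∷_)
open import Function.Base using (id; _∘_; _on_)
open import Function.Bundles using (Equivalence; mk⇔) renaming (_⇔_ to _iff_)
open import Function.Construct.Composition using (_⇔-∘_)
open import Function.Construct.Identity using (⇔-id)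
open import Function.Construct.Symmetry using (⇔-sym)
open import Function.Definitions using (StrictlySurjective)
open import Function.Related.TypeIsomorphisms using (→-cong-⇔; ¬-cong-⇔)
import Relation.Binary.Construct.On as On
open import Relation.Binary.PropositionalEquality using (_≡_; refl; sym; cong; cong₂; subst)
open import Relation.Binary.Structures using (IsEquivalence)
open import Relation.Nullary.Decidable using (yes; no; ¬¬-excluded-middle)
open import Relation.Nullary.Negation using (¬_; Stable; negated-stable; ¬¬-map; contradiction)
open import Relation.Unary using (Pred; ∅; _∪_)
open import Defs

open Equivalence using (to; from)
open Frame using (World)

-- Double negation and stability of forcing.

¬¬-cong : ∀ {A B : Set} → A iff B → (¬ ¬ A) iff (¬ ¬ B)
¬¬-cong e = ¬-cong-⇔ (¬-cong-⇔ e)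

∃-cong : ∀ {A : Set} {B C : A → Set} → (∀ x → B x iff C x) → ∃ B iff ∃ C
∃-cong e = mk⇔ (λ (x , b) → x , to (e x) b) (λ (x , c) → x , from (e x) c)

¬¬-bind : ∀ {A B : Set} → Stable B → (A → B) → ¬ ¬ A → B
¬¬-bind s f = s ∘ ¬¬-map f

Valuation : Set → Set₁
Valuation W = Var → Pred W 0ℓ

infix 4 _∣_∣_⊩_
infixl 10 _[p↦_]

_∣_∣_⊩_ : (F : Frame) → Valuation (World F) → World F → Fm → Set
F ∣ V ∣ w ⊩ φ = Forcing._⊩_ F V w φ

-- Reinterpreting `p` by an arbitrary predicate, definable or not, is what lets additivity be
-- applied to pieces of `p` for which no formula is at hand.
_[p↦_] : ∀ {W} → Valuation W → Pred W 0ℓ → Valuation W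
(V [p↦ P ]) p       = P
(V [p↦ P ]) q       = V q
(V [p↦ P ]) (par i) = V (par i)

module _ (F : Frame) (V : Valuation (World F)) where
  open Forcing F V

  -- This licenses classical case distinctions whenever the goal is a forcing statement. The clauses
  -- for variables, `∼`, `◇` and `∨` are negations; `□`, `∧` and `⇒` inherit stability from their
  -- subformulas.
  ⊩-stable : ∀ φ {w} → Stable (w ⊩ φ)
  ⊩-stable (var v) = negated-stable
  ⊩-stable ⊥ k = k id
  ⊩-stable ⊤ k = _
  ⊩-stable (∼ φ) = negated-stable
  ⊩-stable (□ φ) k u wRu = ⊩-stable φ (¬¬-map (λ h → h u wRu) k)
  ⊩-stable (◇ φ) = negated-stable
  ⊩-stable (φ ∧ ψ) k = ⊩-stable φ (¬¬-map proj₁ k) , ⊩-stable ψ (¬¬-map proj₂ k)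
  ⊩-stable (φ ∨ ψ) = negated-stable
  ⊩-stable (φ ⇒ ψ) k h = ⊩-stable ψ (¬¬-map (λ f → f h) k)

  ⊩-⋁ : ∀ {k w} (f : Fin k → Fm) → (w ⊩ ⋁ f) iff (¬ ¬ (∃[ i ] (w ⊩ f i)))
  ⊩-⋁ {k} {w} f = mk⇔ (fwd f) (λ k → ⊩-stable (⋁ f) (¬¬-map (λ (i , h) → bwd f i h) k))
    where
    fwd : ∀ {k} (f : Fin k → Fm) → w ⊩ ⋁ f → ¬ ¬ (∃[ i ] (w ⊩ f i))
    fwd {suc k} f = ¬¬-bind negated-stable
      [ (λ h ¬e → ¬e (zero , h)) , (λ h → ¬¬-map (λ (i , h′) → suc i , h′) (fwd (f ∘ suc) h)) ]′
    bwd : ∀ {k} (f : Fin k → Fm) i → w ⊩ f i → w ⊩ ⋁ f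
    bwd f zero h ¬e = ¬e (inj₁ h)
    bwd f (suc i) h ¬e = ¬e (inj₂ (bwd (f ∘ suc) i h))

[p≔p]-id : ∀ φ → φ [p≔ var p ] ≡ φ
[p≔p]-id (var p) = refl
[p≔p]-id (var q) = refl
[p≔p]-id (var (par i)) = refl
[p≔p]-id ⊥ = refl
[p≔p]-id ⊤ = refl
[p≔p]-id (∼ φ) = cong ∼_ ([p≔p]-id φ)
[p≔p]-id (□ φ) = cong □_ ([p≔p]-id φ)
[p≔p]-id (◇ φ) = cong ◇_ ([p≔p]-id φ)
[p≔p]-id (φ ∧ ψ) = cong₂ _∧_ ([p≔p]-id φ) ([p≔p]-id ψ)
[p≔p]-id (φ ∨ ψ) = cong₂ _∨_ ([p≔p]-id φ) ([p≔p]-id ψ)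
[p≔p]-id (φ ⇒ ψ) = cong₂ _⇒_ ([p≔p]-id φ) ([p≔p]-id ψ)

-- Pullback along surjections, and substitution for `p`.

pullback : (F : Frame) {W : Set} → (W → World F) → Frame
pullback F f = record { World = _ ; _R_ = Frame._R_ F on f }

module Pullback
  (F : Frame) (equiv : IsEquivalence (Frame._R_ F))
  {W : Set} (f : W → World F) (surj : StrictlySurjective _≡_ f)
  (V : Valuation (World F)) (V′ : Valuation W) (w : World F) where

  open Frame F using (_R_)
  open IsEquivalence equiv using (trans)
  open Forcing F V
  open Forcing (pullback F f) V′ renaming (_⊩_ to _⊩′_)

  -- A single induction yields both invariance under a surjective bounded morphism (`χ` is `p`) and
  -- the substitution lemma (`f` is the identity). Agreement on variables is asked only in the
  -- cluster of `w`, and transitivity keeps `□` and `◇` inside it.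
  ⊩-subst : ∀ χ φ →
    (∀ v → v ∈ vars φ → ∀ u → w R f u → (u ⊩′ var v) iff (f u ⊩ var v [p≔ χ ])) →
    ∀ u → w R f u → (u ⊩′ φ) iff (f u ⊩ φ [p≔ χ ])
  ⊩-subst χ (var v) hyp = hyp v (here refl)
  ⊩-subst χ ⊥ hyp u wRu = ⇔-id _
  ⊩-subst χ ⊤ hyp u wRu = ⇔-id _
  ⊩-subst χ (∼ φ) hyp u wRu = ¬-cong-⇔ (⊩-subst χ φ hyp u wRu)
  ⊩-subst χ (□ φ) hyp u wRu = mk⇔ fwd
    (λ h x uRx → from (⊩-subst χ φ hyp x (trans wRu uRx)) (h (f x) uRx))
    where
    fwd : u ⊩′ □ φ → f u ⊩ □ φ [p≔ χ ]
    fwd h y uRy with surj y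
    ... | x , refl = to (⊩-subst χ φ hyp x (trans wRu uRy)) (h x uRy)
  ⊩-subst χ (◇ φ) hyp u wRu = mk⇔
    (¬¬-map λ (x , uRx , h) → f x , uRx , to (⊩-subst χ φ hyp x (trans wRu uRx)) h)
    (¬¬-map bwd)
    where
    bwd : ∃[ y ] (f u R y × y ⊩ φ [p≔ χ ]) → ∃[ x ] (f u R f x × x ⊩′ φ)
    bwd (y , uRy , h) with surj y
    ... | x , refl = x , uRy , from (⊩-subst χ φ hyp x (trans wRu uRy)) h
  ⊩-subst χ (φ ∧ ψ) hyp u wRu =
    ⊩-subst χ φ (λ v → hyp v ∘ ∈-++⁺ˡ) u wRu ×-⇔ ⊩-subst χ ψ (λ v → hyp v ∘ ∈-++⁺ʳ _) u wRu
  ⊩-subst χ (φ ∨ ψ) hyp u wRu = ¬¬-cong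
    (⊩-subst χ φ (λ v → hyp v ∘ ∈-++⁺ˡ) u wRu ⊎-⇔ ⊩-subst χ ψ (λ v → hyp v ∘ ∈-++⁺ʳ _) u wRu)
  ⊩-subst χ (φ ⇒ ψ) hyp u wRu = →-cong-⇔
    (⊩-subst χ φ (λ v → hyp v ∘ ∈-++⁺ˡ) u wRu) (⊩-subst χ ψ (λ v → hyp v ∘ ∈-++⁺ʳ _) u wRu)

  ⊩-subst-p : ∀ χ φ → q ∉ vars φ →
    (∀ i u → V′ (par i) u ≡ V (par i) (f u)) →
    (∀ u → w R f u → (¬ ¬ V′ p u) iff (f u ⊩ χ)) →
    ∀ u → w R f u → (u ⊩′ φ) iff (f u ⊩ φ [p≔ χ ])
  ⊩-subst-p χ φ q∉φ V-par V-p = ⊩-subst χ φ λ where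
    p       _   u wRu → V-p u wRu
    q       q∈φ       → contradiction q∈φ q∉φ
    (par i) _   u wRu → subst (λ A → (¬ ¬ A) iff (¬ ¬ V (par i) (f u))) (sym (V-par i u)) (⇔-id _)

  ⊩-pullback : ∀ φ → q ∉ vars φ →
    (∀ i u → V′ (par i) u ≡ V (par i) (f u)) →
    (∀ u → w R f u → (¬ ¬ V′ p u) iff (¬ ¬ V p (f u))) →
    ∀ u → w R f u → (u ⊩′ φ) iff (f u ⊩ φ)
  ⊩-pullback φ q∉φ V-par V-p u wRu =
    subst (λ ψ → (u ⊩′ φ) iff (f u ⊩ ψ)) ([p≔p]-id φ) (⊩-subst-p (var p) φ q∉φ V-par V-p u wRu)

module _ (F : Frame) (equiv : IsEquivalence (Frame._R_ F)) where
  open IsEquivalence equiv using () renaming (refl to R-refl)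

  ⊩-[p≔] : ∀ V V′ χ φ → q ∉ vars φ →
    (∀ i u → V′ (par i) u ≡ V (par i) u) →
    (∀ u → (¬ ¬ V′ p u) iff (F ∣ V ∣ u ⊩ χ)) →
    ∀ w → (F ∣ V′ ∣ w ⊩ φ) iff (F ∣ V ∣ w ⊩ φ [p≔ χ ])
  ⊩-[p≔] V V′ χ φ q∉φ V-par V-p w =
    Pullback.⊩-subst-p F equiv id (λ u → u , refl) V V′ w χ φ q∉φ V-par (λ u _ → V-p u) w R-refl

  ⊩-cong-p : ∀ V P Q φ → q ∉ vars φ → (∀ u → (¬ ¬ P u) iff (¬ ¬ Q u)) →
    ∀ w → (F ∣ V [p↦ P ] ∣ w ⊩ φ) iff (F ∣ V [p↦ Q ] ∣ w ⊩ φ)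
  ⊩-cong-p V P Q φ q∉φ P⇔Q w = Pullback.⊩-pullback F equiv id (λ u → u , refl)
    (V [p↦ Q ]) (V [p↦ P ]) w φ q∉φ (λ _ _ → refl) (λ u _ → P⇔Q u) w R-refl

  ⊩-param : ∀ V P {n} (r : Vec ℕ n) φ → φ ∈Fm pars r →
    ∀ w → (F ∣ V [p↦ P ] ∣ w ⊩ φ) iff (F ∣ V ∣ w ⊩ φ)
  ⊩-param V P r φ φ∈ w = subst (λ ψ → (F ∣ V [p↦ P ] ∣ w ⊩ φ) iff (F ∣ V ∣ w ⊩ ψ)) ([p≔p]-id φ)
    (Pullback.⊩-subst F equiv id (λ u → u , refl) V (V [p↦ P ]) w (var p) φ var-param w R-refl)
    where
    var-param : ∀ v → v ∈ vars φ → ∀ u → _ →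
      (F ∣ V [p↦ P ] ∣ u ⊩ var v) iff (F ∣ V ∣ u ⊩ var v [p≔ var p ])
    var-param v v∈φ u _ with ∈-map⁻ par (φ∈ v∈φ)
    ... | i , _ , refl = ⇔-id _

-- Normality and additivity as conditions on predicates.

SemanticallyNormal : Fm → Set₁
SemanticallyNormal φ = ∀ F → IsEquivalence (Frame._R_ F) → ∀ V w → ¬ (F ∣ V [p↦ ∅ ] ∣ w ⊩ φ)

SemanticallyAdditive : Fm → Set₁
SemanticallyAdditive φ = ∀ F → IsEquivalence (Frame._R_ F) → ∀ V w P Q →
  (F ∣ V [p↦ P ∪ Q ] ∣ w ⊩ φ) iff (¬ ¬ ((F ∣ V [p↦ P ] ∣ w ⊩ φ) ⊎ (F ∣ V [p↦ Q ] ∣ w ⊩ φ)))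

module _ {φ : Fm} (q∉φ : q ∉ vars φ) where

  normal⇔ : Normal S5 φ iff SemanticallyNormal φ
  normal⇔ = mk⇔
    (λ norm F equiv V w → proj₁ (norm F equiv V w) ∘ to (⊩-⊥ F equiv V w))
    (λ norm F equiv V w → norm F equiv V w ∘ from (⊩-⊥ F equiv V w) , λ ())
    where
    ⊩-⊥ : ∀ F → IsEquivalence (Frame._R_ F) → ∀ V w →
      (F ∣ V [p↦ ∅ ] ∣ w ⊩ φ) iff (F ∣ V ∣ w ⊩ φ [p≔ ⊥ ])
    ⊩-⊥ F equiv V = ⊩-[p≔] F equiv V (V [p↦ ∅ ]) ⊥ φ q∉φ (λ _ _ → refl)
      (λ _ → mk⇔ (λ k → k id) λ ())

  module _ (F : Frame) (equiv : IsEquivalence (Frame._R_ F)) (U V : Valuation (World F))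
    (V-par : ∀ i u → V (par i) u ≡ U (par i) u) where

    -- `U` supplies the two predicates as its values at `p` and `q`, while `V` is the valuation
    -- being modified. The forward half of `additive⇔` builds `U` from given predicates; the
    -- backward half takes `U` to be `V`.
    ⊩-p∨q : ∀ w → (F ∣ V [p↦ U p ∪ U q ] ∣ w ⊩ φ) iff (F ∣ U ∣ w ⊩ φ [p≔ var p ∨ var q ])
    ⊩-p∨q = ⊩-[p≔] F equiv U (V [p↦ U p ∪ U q ]) (var p ∨ var q) φ q∉φ V-par
      λ u → mk⇔ (¬¬-map (Sum.map contradiction contradiction))
                (λ h ¬pq → h [ (λ h → h (¬pq ∘ inj₁)) , (λ h → h (¬pq ∘ inj₂)) ]′)

    ⊩-p⊎q : ∀ w →
      (¬ ¬ ((F ∣ V [p↦ U p ] ∣ w ⊩ φ) ⊎ (F ∣ V [p↦ U q ] ∣ w ⊩ φ)))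
      iff (F ∣ U ∣ w ⊩ φ [p≔ var p ] ∨ φ [p≔ var q ])
    ⊩-p⊎q w = ¬¬-cong
      (⊩-[p≔] F equiv U (V [p↦ U p ]) (var p) φ q∉φ V-par (λ _ → ⇔-id _) w
        ⊎-⇔ ⊩-[p≔] F equiv U (V [p↦ U q ]) (var q) φ q∉φ V-par (λ _ → ⇔-id _) w)

  additive⇔ : Additive S5 φ iff SemanticallyAdditive φ
  additive⇔ = mk⇔ fwd bwd
    where
    fwd : Additive S5 φ → SemanticallyAdditive φ
    fwd add F equiv V w P Q = ⇔-sym (⊩-p⊎q F equiv U V (λ _ _ → refl) w)
      ⇔-∘ (mk⇔ (proj₁ (add F equiv U w)) (proj₂ (add F equiv U w))
      ⇔-∘ ⊩-p∨q F equiv U V (λ _ _ → refl) w)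
      where
      -- Since `q` does not occur in `φ`, it is free to name the second predicate.
      U : Valuation (World F)
      U p       = P
      U q       = Q
      U (par i) = V (par i)
    bwd : SemanticallyAdditive φ → Additive S5 φ
    bwd add F equiv V w = to equivalence , from equivalence
      where
      equivalence : (F ∣ V ∣ w ⊩ φ [p≔ var p ∨ var q ]) iff (F ∣ V ∣ w ⊩ φ [p≔ var p ] ∨ φ [p≔ var q ])
      equivalence = ⊩-p⊎q F equiv V V (λ _ _ → refl) w
        ⇔-∘ (add F equiv V w (V p) (V q)
        ⇔-∘ ⇔-sym (⊩-p∨q F equiv V V (λ _ _ → refl) w))

-- Induction on the number of pieces: normality settles the empty union, and additivity splits off
-- one piece.
⊩-⋃ : ∀ {φ} → q ∉ vars φ → SemanticallyNormal φ → SemanticallyAdditive φ →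
  ∀ F → IsEquivalence (Frame._R_ F) → ∀ V w {k} (P : Fin k → Pred (World F) 0ℓ) →
  (F ∣ V [p↦ (λ u → ∃[ i ] P i u) ] ∣ w ⊩ φ) iff (¬ ¬ (∃[ i ] (F ∣ V [p↦ P i ] ∣ w ⊩ φ)))
⊩-⋃ {φ} q∉φ norm add F equiv V w {zero} P = mk⇔
  (λ h _ → norm F equiv V w
    (to (⊩-cong-p F equiv V _ ∅ φ q∉φ (λ u → ¬¬-cong (mk⇔ (λ ()) (λ ()))) w) h))
  (¬¬-bind (⊩-stable F _ φ) λ ())
⊩-⋃ {φ} q∉φ norm add F equiv V w {suc k} P =
  mk⇔ (¬¬-bind negated-stable
         [ (λ h ¬e → ¬e (zero , h)) , (λ h → ¬¬-map (λ (i , h) → suc i , h) (to ih h)) ]′)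
      (¬¬-map λ { (zero , h) → inj₁ h ; (suc i , h) → inj₂ (from ih (contradiction (i , h))) })
  ⇔-∘ (add F equiv V w (P zero) (λ u → ∃[ i ] P (suc i) u)
  ⇔-∘ ⊩-cong-p F equiv V _ (P zero ∪ λ u → ∃[ i ] P (suc i) u) φ q∉φ (λ u → ¬¬-cong split) w)
  where
  ih = ⊩-⋃ q∉φ norm add F equiv V w (P ∘ suc)
  split : ∀ {u} → (∃[ i ] P i u) iff (P zero ∪ λ u → ∃[ i ] P (suc i) u) u
  split = mk⇔ (λ { (zero , h) → inj₁ h ; (suc i , h) → inj₂ (i , h) })
              [ (λ h → zero , h) , (λ (i , h) → suc i , h) ]′

-- Normal forms are normal and additive.

normalForm : ∀ {k} → Fm → (Fin k → Fm) → (Fin k → Fm) → Fm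
normalForm l μ ν = (l ∧ var p) ∨ ⋁ (λ i → μ i ∧ ◇ (ν i ∧ var p)) ∨ ⊥

module _ {k} (l : Fm) (μ ν : Fin k → Fm) where

  -- The truth condition of the normal form, with the outer double negations stripped and the
  -- extension `P` of `p` separated from the valuation. `P` occurs once in each disjunct, under
  -- conjunctions and existential quantifiers only, so distribution over unions is mere
  -- rearrangement.
  HereOrThere : (F : Frame) → Valuation (World F) → Pred (World F) 0ℓ → Pred (World F) 0ℓ
  HereOrThere F V P w =
    (w ⊩ l × P w) ⊎ (∃[ i ] (w ⊩ μ i × ∃[ u ] (w R u × u ⊩ ν i × P u)))
    where
    open Frame F
    open Forcing F V

  HereOrThere-cong : ∀ F V V′ P w →
    (∀ u → (F ∣ V ∣ u ⊩ l) iff (F ∣ V′ ∣ u ⊩ l)) →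
    (∀ i u → (F ∣ V ∣ u ⊩ μ i) iff (F ∣ V′ ∣ u ⊩ μ i)) →
    (∀ i u → (F ∣ V ∣ u ⊩ ν i) iff (F ∣ V′ ∣ u ⊩ ν i)) →
    HereOrThere F V P w iff HereOrThere F V′ P w
  HereOrThere-cong F V V′ P w l⇔ μ⇔ ν⇔ =
    (l⇔ w ×-⇔ ⇔-id _) ⊎-⇔
    ∃-cong λ i → μ⇔ i w ×-⇔ ∃-cong λ u → ⇔-id _ ×-⇔ ν⇔ i u ×-⇔ ⇔-id _

  HereOrThere-∪ : ∀ F V P Q w →
    HereOrThere F V (P ∪ Q) w iff (HereOrThere F V P w ⊎ HereOrThere F V Q w)
  HereOrThere-∪ F V P Q w = mk⇔
    (λ { (inj₁ (h , inj₁ x)) → inj₁ (inj₁ (h , x))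
       ; (inj₁ (h , inj₂ x)) → inj₂ (inj₁ (h , x))
       ; (inj₂ (i , h , u , r , g , inj₁ x)) → inj₁ (inj₂ (i , h , u , r , g , x))
       ; (inj₂ (i , h , u , r , g , inj₂ x)) → inj₂ (inj₂ (i , h , u , r , g , x)) })
    [ Sum.map (λ (h , x) → h , inj₁ x) (λ (i , h , u , r , g , x) → i , h , u , r , g , inj₁ x)
    , Sum.map (λ (h , x) → h , inj₂ x) (λ (i , h , u , r , g , x) → i , h , u , r , g , inj₂ x) ]′

  ⊩-normalForm : ∀ F V w →
    (F ∣ V ∣ w ⊩ normalForm l μ ν) iff (¬ ¬ HereOrThere F V (V p) w)
  ⊩-normalForm F V w = mk⇔ fwd (¬¬-map bwd)
    where
    open Frame F
    open Forcing F V
    disjunct : Fin k → Fm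
    disjunct i = μ i ∧ ◇ (ν i ∧ var p)
    there-⇒ : w ⊩ ⋁ disjunct → ¬ ¬ HereOrThere F V (V p) w
    there-⇒ h ¬e = to (⊩-⋁ F V disjunct) h λ (i , hμ , h◇) →
      h◇ λ (u , r , hν , hp) → hp λ x → ¬e (inj₂ (i , hμ , u , r , hν , x))
    fwd : w ⊩ normalForm l μ ν → ¬ ¬ HereOrThere F V (V p) w
    fwd = ¬¬-bind negated-stable
      [ (λ (hl , hp) → ¬¬-map (λ x → inj₁ (hl , x)) hp)
      , ¬¬-bind negated-stable [ there-⇒ , (λ ()) ]′ ]′
    bwd : HereOrThere F V (V p) w → w ⊩ l ∧ var p ⊎ w ⊩ ⋁ disjunct ∨ ⊥
    bwd (inj₁ (hl , x)) = inj₁ (hl , contradiction x)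
    bwd (inj₂ (i , hμ , u , r , hν , x)) = inj₂ (contradiction (inj₁ (from (⊩-⋁ F V disjunct)
      (contradiction (i , hμ , contradiction (u , r , hν , contradiction x))))))

module _ {n k} (r : Vec ℕ n) (l : Fm) (μ ν : Fin k → Fm)
  (l∈ : l ∈Fm pars r) (μ∈ : ∀ i → μ i ∈Fm pars r) (ν∈ : ∀ i → ν i ∈Fm pars r) where

  ⊩-normalForm-p : ∀ F → IsEquivalence (Frame._R_ F) → ∀ V P w →
    (F ∣ V [p↦ P ] ∣ w ⊩ normalForm l μ ν) iff (¬ ¬ HereOrThere l μ ν F V P w)
  ⊩-normalForm-p F equiv V P w = ¬¬-cong
    (HereOrThere-cong l μ ν F (V [p↦ P ]) V P w (⊩-param F equiv V P r l l∈)
      (λ i → ⊩-param F equiv V P r (μ i) (μ∈ i)) (λ i → ⊩-param F equiv V P r (ν i) (ν∈ i)))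
    ⇔-∘ ⊩-normalForm l μ ν F (V [p↦ P ]) w

  -- Both disjuncts ask for an element of the extension of `p`.
  normalForm-normal : SemanticallyNormal (normalForm l μ ν)
  normalForm-normal F equiv V w h = to (⊩-normalForm-p F equiv V ∅ w) h
    λ { (inj₁ (_ , ())) ; (inj₂ (_ , _ , _ , _ , _ , ())) }

  normalForm-additive : SemanticallyAdditive (normalForm l μ ν)
  normalForm-additive F equiv V w P Q =
    mk⇔ (¬¬-map (Sum.map (from (nf P) ∘ contradiction) (from (nf Q) ∘ contradiction)))
        (¬¬-bind negated-stable
          [ (λ h → ¬¬-map inj₁ (to (nf P) h)) , (λ h → ¬¬-map inj₂ (to (nf Q) h)) ]′)
    ⇔-∘ (¬¬-cong (HereOrThere-∪ l μ ν F V P Q w) ⇔-∘ nf (P ∪ Q))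
    where nf = λ P → ⊩-normalForm-p F equiv V P w

Equivalent-normal : ∀ φ ψ → Equivalent S5 φ ψ → SemanticallyNormal ψ → SemanticallyNormal φ
Equivalent-normal φ ψ φ⇔ψ norm F equiv V w h = norm F equiv V w (proj₁ (φ⇔ψ F equiv _ w) h)

Equivalent-additive : ∀ φ ψ → Equivalent S5 φ ψ → SemanticallyAdditive ψ → SemanticallyAdditive φ
Equivalent-additive φ ψ φ⇔ψ add F equiv V w P Q =
  ⇔-sym (¬¬-cong (equivalence P ⊎-⇔ equivalence Q))
  ⇔-∘ (add F equiv V w P Q ⇔-∘ equivalence (P ∪ Q))
  where
  equivalence : ∀ P → (F ∣ V [p↦ P ] ∣ w ⊩ φ) iff (F ∣ V [p↦ P ] ∣ w ⊩ ψ)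
  equivalence P = mk⇔ (proj₁ (φ⇔ψ F equiv _ w)) (proj₂ (φ⇔ψ F equiv _ w))

-- Evaluation by parameter formulas.

constant : Bool → Fm
constant b = if b then ⊤ else ⊥

-- Consider a model in which every world has an unmarked copy outside p, while the worlds in p, the
-- marked ones, are nonempty in every cluster and all satisfy the parameters according to β.  Then
-- evaluate β e φ is the parameter formula that gives the value of φ at a world, marked iff e.
evaluate : (ℕ → Bool) → Bool → Fm → Fm
evaluate β e     (var p)       = constant e
evaluate β e     (var q)       = ⊥
evaluate β false (var (par i)) = var (par i)
evaluate β true  (var (par i)) = constant (β i)
evaluate β e     ⊥             = ⊥
evaluate β e     ⊤             = ⊤
evaluate β e     (∼ φ)         = ∼ evaluate β e φ
evaluate β e     (□ φ)         = □ evaluate β false φ ∧ evaluate β true φ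
evaluate β e     (◇ φ)         = ◇ evaluate β false φ ∨ evaluate β true φ
evaluate β e     (φ ∧ ψ)       = evaluate β e φ ∧ evaluate β e ψ
evaluate β e     (φ ∨ ψ)       = evaluate β e φ ∨ evaluate β e ψ
evaluate β e     (φ ⇒ ψ)       = evaluate β e φ ⇒ evaluate β e ψ

++-⊆ : ∀ {A : Set} {xs ys zs : List A} → xs ⊆ zs → ys ⊆ zs → xs ++ ys ⊆ zs
++-⊆ {xs = xs} xs⊆ ys⊆ = [ xs⊆ , ys⊆ ]′ ∘ ∈-++⁻ xs

++-⊆ˡ : ∀ {A : Set} {xs ys zs : List A} → xs ++ ys ⊆ zs → xs ⊆ zs
++-⊆ˡ h = h ∘ ∈-++⁺ˡ

++-⊆ʳ : ∀ {A : Set} (xs : List A) {ys zs} → xs ++ ys ⊆ zs → ys ⊆ zs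
++-⊆ʳ xs h = h ∘ ∈-++⁺ʳ xs

constant-∈Fm : ∀ b {vs} → constant b ∈Fm vs
constant-∈Fm false ()
constant-∈Fm true  ()

⋁-∈Fm : ∀ {k} (f : Fin k → Fm) {vs} → (∀ i → f i ∈Fm vs) → ⋁ f ∈Fm vs
⋁-∈Fm {zero}  f f∈ ()
⋁-∈Fm {suc k} f f∈ = ++-⊆ (f∈ zero) (⋁-∈Fm (f ∘ suc) (f∈ ∘ suc))

evaluate-∈Fm : ∀ β e φ {vs} → φ ∈Fm (p ∷ vs) → evaluate β e φ ∈Fm vs
evaluate-∈Fm β e (var p) φ∈ = constant-∈Fm e
evaluate-∈Fm β e (var q) φ∈ ()
evaluate-∈Fm β false (var (par i)) φ∈ (here refl) with φ∈ (here refl)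
... | there i∈ = i∈
evaluate-∈Fm β true (var (par i)) φ∈ = constant-∈Fm (β i)
evaluate-∈Fm β e ⊥ φ∈ ()
evaluate-∈Fm β e ⊤ φ∈ ()
evaluate-∈Fm β e (∼ φ) φ∈ = evaluate-∈Fm β e φ φ∈
evaluate-∈Fm β e (□ φ) φ∈ =
  ++-⊆ (evaluate-∈Fm β false φ φ∈) (evaluate-∈Fm β true φ φ∈)
evaluate-∈Fm β e (◇ φ) φ∈ =
  ++-⊆ (evaluate-∈Fm β false φ φ∈) (evaluate-∈Fm β true φ φ∈)
evaluate-∈Fm β e (φ ∧ ψ) φ∈ =
  ++-⊆ (evaluate-∈Fm β e φ (++-⊆ˡ φ∈)) (evaluate-∈Fm β e ψ (++-⊆ʳ (vars φ) φ∈))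
evaluate-∈Fm β e (φ ∨ ψ) φ∈ =
  ++-⊆ (evaluate-∈Fm β e φ (++-⊆ˡ φ∈)) (evaluate-∈Fm β e ψ (++-⊆ʳ (vars φ) φ∈))
evaluate-∈Fm β e (φ ⇒ ψ) φ∈ =
  ++-⊆ (evaluate-∈Fm β e φ (++-⊆ˡ φ∈)) (evaluate-∈Fm β e ψ (++-⊆ʳ (vars φ) φ∈))

q∉p∷pars : ∀ {n} (r : Vec ℕ n) → q ∉ p ∷ pars r
q∉p∷pars r (there q∈) with ∈-map⁻ par q∈
... | _ , _ , ()

-- Truth in a doubled model with marked worlds.

module Marking
  (F : Frame) (equiv : IsEquivalence (Frame._R_ F)) (V : Valuation (World F))
  {n} (r : Vec ℕ n) (β : ℕ → Bool) (Y : Pred (World F) 0ℓ)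
  (Y-β : ∀ {u} → Y u → ∀ {i} → par i ∈ pars r →
    (F ∣ V ∣ u ⊩ var (par i)) iff (F ∣ V ∣ u ⊩ constant (β i)))
  (d : Bool) {x : World F} (x∈Y : Y x) where

  open Frame F using (_R_)
  open IsEquivalence equiv using () renaming (refl to R-refl; sym to R-sym; trans to R-trans)

  Marked : Pred (World F × Bool) 0ℓ
  Marked (u , c) = c ≡ d × Y u

  open Forcing F V
  open Forcing (pullback F proj₁) ((λ v → V v ∘ proj₁) [p↦ Marked ]) renaming (_⊩_ to _⊩′_)

  -- An unmarked copy lies over `u` itself, whereas a marked one may lie over any world of the
  -- cluster of `u`: marked worlds of one cluster cannot be told apart by formulas over `p` and `r`,
  -- so `evaluate β true φ` may be read anywhere in the cluster.
  data Copy : Bool → World F → World F × Bool → Set where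
    unmarked : ∀ {u c} → ¬ Marked (u , c) → Copy false u (u , c)
    marked   : ∀ {u u′ c} → u R u′ → Marked (u′ , c) → Copy true u (u′ , c)

  Copy-R : ∀ {e u n} → Copy e u n → u R proj₁ n
  Copy-R (unmarked _) = R-refl
  Copy-R (marked r _) = r

  -- This is where doubling enters: marks occupy the layer `d` only, so each world, even one in `Y`,
  -- keeps a copy outside `p`.
  opposite-unmarked : ∀ {u} → Copy false u (u , not d)
  opposite-unmarked = unmarked λ (eq , _) → not-¬ refl (sym eq)

  ⊩-constant : ∀ b {u v} → (u ⊩ constant b) iff (v ⊩ constant b)
  ⊩-constant false = ⇔-id _
  ⊩-constant true  = ⇔-id _

  -- In the modal cases the worlds accessible from `n` are of two sorts: the unmarked ones, which by
  -- `opposite-unmarked` cover the whole cluster, and the marked ones, which all agree. The premise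
  -- `u R x` guarantees that a marked one exists, namely `(x , d)`.
  ⊩-evaluate : ∀ φ {e u n} → φ ∈Fm (p ∷ pars r) → u R x → Copy e u n →
    (n ⊩′ φ) iff (u ⊩ evaluate β e φ)
  ⊩-evaluate (var p) φ∈ uRx (unmarked ¬m) = mk⇔ (λ h → h ¬m) λ ()
  ⊩-evaluate (var p) φ∈ uRx (marked _ m) = mk⇔ _ (λ _ → contradiction m)
  ⊩-evaluate (var q) φ∈ uRx c = contradiction (φ∈ (here refl)) (q∉p∷pars r)
  ⊩-evaluate (var (par i)) φ∈ uRx (unmarked _) = ⇔-id _
  ⊩-evaluate (var (par i)) φ∈ uRx (marked _ (_ , y)) with φ∈ (here refl)
  ... | there i∈ = ⊩-constant (β i) ⇔-∘ Y-β y i∈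
  ⊩-evaluate ⊥ φ∈ uRx c = ⇔-id _
  ⊩-evaluate ⊤ φ∈ uRx c = ⇔-id _
  ⊩-evaluate (∼ φ) φ∈ uRx c = ¬-cong-⇔ (⊩-evaluate φ φ∈ uRx c)
  ⊩-evaluate (□ φ) {e} {u} {n} φ∈ uRx c = mk⇔
    (λ h → (λ v uRv → to (⊩-evaluate φ φ∈ (R-trans (R-sym uRv) uRx) opposite-unmarked)
                          (h (v , not d) (R-trans (R-sym (Copy-R c)) uRv)))
         , to (⊩-evaluate φ φ∈ uRx (marked uRx (refl , x∈Y)))
              (h (x , d) (R-trans (R-sym (Copy-R c)) uRx)))
    bwd
    where
    bwd : u ⊩ evaluate β e (□ φ) → n ⊩′ □ φ
    -- Whether `m` is marked is settled classically, the goal being stable; `h₁` serves the marked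
    -- case and `h₀` the other.
    bwd (h₀ , h₁) m nRm = ¬¬-bind (⊩-stable _ _ φ)
      (λ { (yes y) → from (⊩-evaluate φ φ∈ uRx (marked (R-trans (Copy-R c) nRm) y)) h₁
         ; (no ¬y) → from (⊩-evaluate φ φ∈ (R-trans (R-sym (R-trans (Copy-R c) nRm)) uRx) (unmarked ¬y))
                          (h₀ _ (R-trans (Copy-R c) nRm)) })
      ¬¬-excluded-middle
  ⊩-evaluate (◇ φ) {e} {u} {n} φ∈ uRx c = mk⇔ (¬¬-bind negated-stable fwd)
    (¬¬-bind negated-stable
      [ ¬¬-map (λ (v , uRv , h) → (v , not d) , R-trans (R-sym (Copy-R c)) uRv ,
          from (⊩-evaluate φ φ∈ (R-trans (R-sym uRv) uRx) opposite-unmarked) h)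
      , (λ h → contradiction ((x , d) , R-trans (R-sym (Copy-R c)) uRx ,
          from (⊩-evaluate φ φ∈ uRx (marked uRx (refl , x∈Y))) h)) ]′)
    where
    fwd : ∃[ m ] (proj₁ n R proj₁ m × m ⊩′ φ) → u ⊩ evaluate β e (◇ φ)
    fwd (m , nRm , h) = ¬¬-map
      (λ { (yes y) → inj₂ (to (⊩-evaluate φ φ∈ uRx (marked (R-trans (Copy-R c) nRm) y)) h)
         ; (no ¬y) → inj₁ (contradiction (proj₁ m , R-trans (Copy-R c) nRm ,
             to (⊩-evaluate φ φ∈ (R-trans (R-sym (R-trans (Copy-R c) nRm)) uRx) (unmarked ¬y)) h)) })
      ¬¬-excluded-middle
  ⊩-evaluate (φ ∧ ψ) φ∈ uRx c =
    ⊩-evaluate φ (++-⊆ˡ φ∈) uRx c ×-⇔ ⊩-evaluate ψ (++-⊆ʳ (vars φ) φ∈) uRx c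
  ⊩-evaluate (φ ∨ ψ) φ∈ uRx c = ¬¬-cong
    (⊩-evaluate φ (++-⊆ˡ φ∈) uRx c ⊎-⇔ ⊩-evaluate ψ (++-⊆ʳ (vars φ) φ∈) uRx c)
  ⊩-evaluate (φ ⇒ ψ) φ∈ uRx c = →-cong-⇔
    (⊩-evaluate φ (++-⊆ˡ φ∈) uRx c) (⊩-evaluate ψ (++-⊆ʳ (vars φ) φ∈) uRx c)

-- Atoms over the parameters.

value : ∀ {n} → Vec ℕ n → Vec Bool n → ℕ → Bool
-- An index outside `r` gets the default `false`. For an index repeated in `r` the first bit is
-- returned, which is safe because the atom contains the literal for that bit.
value []      []       j = false
value (i ∷ r) (b ∷ bs) j with i ≟ j
... | yes _ = b
... | no  _ = value r bs j

literal : ℕ → Bool → Fm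
literal i b = if b then var (par i) else ∼ var (par i)

atom : ∀ {n} → Vec ℕ n → Vec Bool n → Fm
atom []      []       = ⊤
atom (i ∷ r) (b ∷ bs) = literal i b ∧ atom r bs

literal-∈Fm : ∀ i b → literal i b ∈Fm [ par i ]
literal-∈Fm i false = id
literal-∈Fm i true  = id

atom-∈Fm : ∀ {n} (r : Vec ℕ n) bs → atom r bs ∈Fm pars r
atom-∈Fm []      []       ()
atom-∈Fm (i ∷ r) (b ∷ bs) = ++⁺ (literal-∈Fm i b) (atom-∈Fm r bs)

valuations : ∀ n → List (Vec Bool n)
valuations zero    = [ [] ]
valuations (suc n) = cartesianProductWith _∷_ (true ∷ false ∷ []) (valuations n)

∈-valuations : ∀ {n} (bs : Vec Bool n) → bs ∈ valuations n
∈-valuations []       = here refl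
∈-valuations (b ∷ bs) = ∈-cartesianProductWith⁺ _∷_ (∈-bools b) (∈-valuations bs)
  where
  ∈-bools : ∀ b → b ∈ true ∷ false ∷ []
  ∈-bools true  = here refl
  ∈-bools false = there (here refl)

module _ (F : Frame) (V : Valuation (World F)) {u : World F} where
  open Forcing F V

  ⊩-literal : ∀ i b → u ⊩ literal i b → (u ⊩ var (par i)) iff (u ⊩ constant b)
  ⊩-literal i false h = mk⇔ h λ ()
  ⊩-literal i true  h = mk⇔ _ λ _ → h

  ⊩-atom : ∀ {n} (r : Vec ℕ n) bs → u ⊩ atom r bs → ∀ {j} → par j ∈ pars r →
    (u ⊩ var (par j)) iff (u ⊩ constant (value r bs j))
  ⊩-atom (i ∷ r) (b ∷ bs) (h , hs) {j} j∈ with i ≟ j | j∈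
  ... | yes refl | _          = ⊩-literal i b h
  ... | no  i≢j  | here refl  = contradiction refl i≢j
  ... | no  _    | there j∈r  = ⊩-atom r bs hs j∈r

  ∃-atom : ∀ {n} (r : Vec ℕ n) → ¬ ¬ (∃[ bs ] (u ⊩ atom r bs))
  ∃-atom []      = contradiction ([] , _)
  ∃-atom (i ∷ r) = ¬¬-bind negated-stable
    (λ { (yes h) → ¬¬-map (λ (bs , hs) → true  ∷ bs , h , hs) (∃-atom r)
       ; (no ¬h) → ¬¬-map (λ (bs , hs) → false ∷ bs , ¬h , hs) (∃-atom r) })
    ¬¬-excluded-middle

-- From a normal additive formula to a normal form.

module Converse {n} (r : Vec ℕ n) (φ : Fm) (φ∈ : φ ∈Fm (p ∷ pars r))
  (norm : SemanticallyNormal φ) (add : SemanticallyAdditive φ) where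

  Index : Set
  Index = Fin (length (valuations n))

  β : Index → ℕ → Bool
  β i = value r (lookup (valuations n) i)

  -- `ν i` is the atom of a piece. `μ i` expresses that `φ` holds at the current world when `p` is a
  -- nonempty piece of that atom, in the same cluster, that omits this world.
  μ ν : Index → Fm
  μ i = evaluate (β i) false φ
  ν i = atom r (lookup (valuations n) i)

  -- The case of a piece containing the current world, which then satisfies the atom itself.
  κ : Index → Fm
  κ i = ν i ∧ evaluate (β i) true φ

  l : Fm
  l = ⋁ κ

  μ∈ : ∀ i → μ i ∈Fm pars r
  μ∈ i = evaluate-∈Fm (β i) false φ φ∈

  ν∈ : ∀ i → ν i ∈Fm pars r
  ν∈ i = atom-∈Fm r (lookup (valuations n) i)

  l∈ : l ∈Fm pars r
  l∈ = ⋁-∈Fm κ λ i → ++-⊆ (ν∈ i) (evaluate-∈Fm (β i) true φ φ∈)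

  q∉φ : q ∉ vars φ
  q∉φ = q∉p∷pars r ∘ φ∈

  module _ (F : Frame) (equiv : IsEquivalence (Frame._R_ F)) (V : Valuation (World F)) (w : World F) where
    open Frame F using (_R_)
    open IsEquivalence equiv using () renaming (refl to R-refl)
    open Forcing F V

    Doubled : Frame
    Doubled = pullback F {World F × Bool} proj₁

    doubled-equiv : IsEquivalence (Frame._R_ Doubled)
    doubled-equiv = On.isEquivalence proj₁ equiv

    w⁺ : World Doubled
    w⁺ = w , true

    V² : Valuation (World Doubled)
    V² v = V v ∘ proj₁

    -- Cutting `p` down to the cluster of `w` preserves truth at `w` and makes every world of a
    -- piece accessible from `w`, as both `Marking` and the disjuncts with `◇` demand.
    Near : Pred (World F) 0ℓ
    Near u = w R u × V p u

    Layer : Bool → Pred (World Doubled) 0ℓ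
    Layer d (u , c) = c ≡ d × Near u

    Piece : Bool → Index → Pred (World Doubled) 0ℓ
    Piece d i (u , c) = c ≡ d × (Near u × u ⊩ ν i)

    -- Truth at `w` moves to the copy `w⁺` along the projection, the two layers together being the
    -- preimage of `p` within the cluster of `w`; additivity then separates them.
    split-layers : (w ⊩ φ) iff
      (¬ ¬ ((Doubled ∣ V² [p↦ Layer true ] ∣ w⁺ ⊩ φ) ⊎ (Doubled ∣ V² [p↦ Layer false ] ∣ w⁺ ⊩ φ)))
    split-layers = add Doubled doubled-equiv V² w⁺ (Layer true) (Layer false)
      ⇔-∘ ⇔-sym (Pullback.⊩-pullback F equiv proj₁ (λ u → (u , true) , refl)
        V (V² [p↦ Layer true ∪ Layer false ]) w φ q∉φ (λ _ _ → refl) V-p w⁺ R-refl)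
      where
      V-p : ∀ u → w R proj₁ u → (¬ ¬ (Layer true ∪ Layer false) u) iff (¬ ¬ V p (proj₁ u))
      V-p (u , true)  wRu = ¬¬-cong (mk⇔ [ proj₂ ∘ proj₂ , proj₂ ∘ proj₂ ]′ (λ x → inj₁ (refl , wRu , x)))
      V-p (u , false) wRu = ¬¬-cong (mk⇔ [ proj₂ ∘ proj₂ , proj₂ ∘ proj₂ ]′ (λ x → inj₂ (refl , wRu , x)))

    -- Up to double negation a layer is the finite union of its pieces, since every world satisfies
    -- some atom.
    split-layer : ∀ d → (Doubled ∣ V² [p↦ Layer d ] ∣ w⁺ ⊩ φ) iff
      (¬ ¬ (∃[ i ] (Doubled ∣ V² [p↦ Piece d i ] ∣ w⁺ ⊩ φ)))
    split-layer d = ⊩-⋃ q∉φ norm add Doubled doubled-equiv V² w⁺ (Piece d)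
      ⇔-∘ ⊩-cong-p Doubled doubled-equiv V² (Layer d) _ φ q∉φ
        (λ (u , c) → mk⇔
          (¬¬-bind negated-stable λ (eq , near) → ¬¬-map (λ (i , h) → i , eq , near , h) (∃-ν u))
          (¬¬-map λ (i , eq , near , h) → eq , near)) w⁺
      where
      ∃-ν : ∀ u → ¬ ¬ (∃[ i ] (u ⊩ ν i))
      ∃-ν u = ¬¬-map (λ (bs , h) → index (∈-valuations bs) ,
        subst (λ bs → u ⊩ atom r bs) (lookup-index (∈-valuations bs)) h) (∃-atom F V r)

    module PieceMarking (d : Bool) (i : Index) {x : World F} (x∈Y : Near x × x ⊩ ν i) =
      Marking F equiv V r (β i) (λ u → Near u × u ⊩ ν i)
        (λ (_ , h) → ⊩-atom F V r (lookup (valuations n) i) h) d x∈Y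

    -- An empty piece is excluded by normality. A nonempty one gives the first disjunct, via `κ i`,
    -- if it contains `w⁺`; otherwise it gives the second, with any world of the piece as witness
    -- for `◇`.
    piece⇒ : ∀ d i → Doubled ∣ V² [p↦ Piece d i ] ∣ w⁺ ⊩ φ → ¬ ¬ HereOrThere l μ ν F V (V p) w
    piece⇒ d i h = ¬¬-bind negated-stable (λ { (yes e) → inhabited e ; (no ¬e) → empty ¬e })
      ¬¬-excluded-middle
      where
      inhabited : ∃[ x ] (Near x × x ⊩ ν i) → ¬ ¬ HereOrThere l μ ν F V (V p) w
      inhabited (x , x∈@((wRx , Vpx) , xν)) = ¬¬-map
        (λ { (yes m@(_ , (_ , Vpw) , wν)) → inj₁
               ( from (⊩-⋁ F V κ) (contradiction (i , wν , to (⊩-evaluate φ φ∈ wRx (marked R-refl m)) h))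
               , Vpw )
           ; (no ¬m) → inj₂ (i , to (⊩-evaluate φ φ∈ wRx (unmarked ¬m)) h , x , wRx , xν , Vpx) })
        (¬¬-excluded-middle {A = Marked w⁺})
        where open PieceMarking d i x∈
      empty : ¬ (∃[ x ] (Near x × x ⊩ ν i)) → ¬ ¬ HereOrThere l μ ν F V (V p) w
      empty ¬e = contradiction (to (⊩-cong-p Doubled doubled-equiv V² _ ∅ φ q∉φ
        (λ (u , c) → ¬¬-cong (mk⇔ (λ (_ , y) → ¬e (u , y)) λ ())) w⁺) h)
        (norm Doubled doubled-equiv V² w⁺)

    piece⇐ : HereOrThere l μ ν F V (V p) w →
      ¬ ¬ (∃[ d ] ∃[ i ] (Doubled ∣ V² [p↦ Piece d i ] ∣ w⁺ ⊩ φ))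
    piece⇐ (inj₁ (hl , Vpw)) = ¬¬-map piece (to (⊩-⋁ F V κ) hl)
      where
      piece : ∃[ i ] (w ⊩ κ i) → ∃[ d ] ∃[ i ] (Doubled ∣ V² [p↦ Piece d i ] ∣ w⁺ ⊩ φ)
      piece (i , wν , h) =
        -- The layer is `true` so that `w⁺` itself belongs to the piece.
        true , i , from (⊩-evaluate φ φ∈ R-refl (marked R-refl (refl , (R-refl , Vpw) , wν))) h
        where open PieceMarking true i ((R-refl , Vpw) , wν)
    piece⇐ (inj₂ (i , hμ , x , wRx , xν , Vpx)) = contradiction
      -- Layer `false` keeps `w⁺` outside the piece even when `w` satisfies both `p` and `ν i`.
      (false , i , from (⊩-evaluate φ φ∈ wRx (unmarked λ ())) hμ)
      where open PieceMarking false i ((wRx , Vpx) , xν)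

    φ⇔normalForm : (w ⊩ φ) iff (w ⊩ normalForm l μ ν)
    φ⇔normalForm = ⇔-sym (⊩-normalForm l μ ν F V w)
      ⇔-∘ (mk⇔ (¬¬-bind negated-stable [ layer⇒ true , layer⇒ false ]′)
               (¬¬-bind negated-stable (¬¬-map layer⇐ ∘ piece⇐))
      ⇔-∘ split-layers)
      where
      layer⇒ : ∀ d → Doubled ∣ V² [p↦ Layer d ] ∣ w⁺ ⊩ φ → ¬ ¬ HereOrThere l μ ν F V (V p) w
      layer⇒ d h = ¬¬-bind negated-stable (λ (i , h) → piece⇒ d i h) (to (split-layer d) h)
      layer⇐ : ∃[ d ] ∃[ i ] (Doubled ∣ V² [p↦ Piece d i ] ∣ w⁺ ⊩ φ) →
        (Doubled ∣ V² [p↦ Layer true ] ∣ w⁺ ⊩ φ) ⊎ (Doubled ∣ V² [p↦ Layer false ] ∣ w⁺ ⊩ φ)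
      layer⇐ (true  , e) = inj₁ (from (split-layer true) (contradiction e))
      layer⇐ (false , e) = inj₂ (from (split-layer false) (contradiction e))

  φ-equivalent : Equivalent S5 φ (normalForm l μ ν)
  φ-equivalent F equiv V w = to (φ⇔normalForm F equiv V w) , from (φ⇔normalForm F equiv V w)

corollary4p5 : ∀ (n : ℕ) (r : Vec ℕ n) (φ : Fm) → φ ∈Fm (p ∷ pars r) →
    NormalAdditive S5 φ
    iff
    (∃[ k ] Σ[ l ∈ Fm ] Σ[ μ ∈ (Fin k → Fm) ] Σ[ ν ∈ (Fin k → Fm) ]
    ( (l ∈Fm pars r)
    × (∀ (i : Fin k) → μ i ∈Fm pars r)
    × (∀ (i : Fin k) → ν i ∈Fm pars r)
    × Equivalent S5 φ
    ((l ∧ var p) ∨ ⋁ (λ i → μ i ∧ ◇ (ν i ∧ var p)) ∨ ⊥) ))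
corollary4p5 n r φ φ∈ = mk⇔
  (λ (norm , add) →
    let module C = Converse r φ φ∈ (to (normal⇔ q∉φ) norm) (to (additive⇔ q∉φ) add)
    in _ , C.l , C.μ , C.ν , C.l∈ , C.μ∈ , C.ν∈ , C.φ-equivalent)
  (λ (k , l , μ , ν , l∈ , μ∈ , ν∈ , φ⇔ψ) →
      from (normal⇔ q∉φ)
        (Equivalent-normal φ (normalForm l μ ν) φ⇔ψ (normalForm-normal r l μ ν l∈ μ∈ ν∈))
    , from (additive⇔ q∉φ)
        (Equivalent-additive φ (normalForm l μ ν) φ⇔ψ (normalForm-additive r l μ ν l∈ μ∈ ν∈)))
  where
  q∉φ : q ∉ vars φ
  q∉φ = q∉p∷pars r ∘ φ∈
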